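{- Let $n\geq 1$, let $I_n=\{0,\ldots,n-1\}$ and let $\mathrm{ND}_n=\{0^k1^{n-k}:0\leq k\leq n\}\subseteq\{0,1\}^n$ be the set of non-decreasing binary sequences of length $n$. The only simplicial complex over $I_n$ generating $\mathrm{ND}_n$ is the full complex $\Delta_{I_n}$, consisting of all subsets of $I_n$.
   Context: All sets are finite (possibly empty). For $f:B^J\to A^I$ write $f_i(x)=f(x)_i$. For $i\in I$, the input window $\mathcal{W}_f(i)$ is the smallest set $W\subseteq J$ (it exists) such that for all $x,y\in B^J$, $x|_W=y|_W$ implies $f_i(x)=f_i(y)$. A simplicial complex (or complex) over $I$ is a collection of subsets of $I$ (its simplices) closed under taking subsets; the empty set is a simplex of every complex. The communication complex $K_f$ of $f$ is the complex over $I$ in which a non-empty $S\subseteq I$ is a simplex iff $\bigcap_{i\in S}\mathcal{W}_f(i)\neq\emptyset$. A complex $K$ over $I$ generates a language $L\subseteq A^I$ if there exist finite sets $B,J$ and a function $f:B^J\to A^I$ with image exactly $L$ and $K_f\subseteq K$. We write $\{0,1\}^n$ for $\{0,1\}^{I_n}$. -}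

module Defs where

open import Data.Bool.Base using (if_then_else_)
open import Data.Empty using (⊥-elim)
open import Data.Fin.Base using (Fin)
open import Data.Fin.Patterns using (0F; 1F)
open import Data.Fin.Properties using (all?; _≟_)
open import Data.Fin.Subset using (Subset; _∈_; _⊆_; _⊂_; _∩_; Nonempty; ⊤; ⊥)
open import Data.Fin.Subset.Induction using (⊂-wellFounded)
open import Data.Fin.Subset.Properties
  using (_∈?_; _⊂?_; anySubset?; x∈p∩q⁻; x∈p∩q⁺; p∩q⊆p; ∈⊤; ∉⊥)
open import Data.Nat.Base using (ℕ; zero; suc; _∸_; _≤_)
open import Data.Nat.Properties using (m+[n∸m]≡n)
open import Data.Product.Base using (Σ; ∃; ∃-syntax; _×_; _,_; proj₁; proj₂)
import Data.Unit.Base as Unit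
open import Data.Vec.Base using (Vec; []; _∷_; lookup; tabulate; replicate; _++_; cast)
open import Data.Vec.Properties using (lookup∘tabulate; tabulate∘lookup; tabulate-cong)
open import Induction.WellFounded using (Acc; acc)
open import Level using (0ℓ)
open import Relation.Binary.PropositionalEquality
  using (_≡_; refl; sym; trans; cong)
open import Relation.Nullary.Decidable
  using (Dec; yes; no; does; map′; _×-dec_; _→-dec_)
open import Relation.Nullary.Negation using (contradiction)
import Relation.Unary as U
open U using (Pred; _≐_)

-- Every finite set (possibly empty) is represented by some Fin k, and a
-- function set B^J by Vec (Fin b) m, on which pointwise equality is _≡_.

private
  variable
    a b m n : ℕ

------------------------------------------------------------------------
-- Input windows

Agree : Subset m → Vec (Fin b) m → Vec (Fin b) m → Set
Agree W x y = ∀ j → j ∈ W → lookup x j ≡ lookup y j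

Determines : (Vec (Fin b) m → Vec (Fin a) n) → Fin n → Pred (Subset m) 0ℓ
Determines f i W = ∀ x y → Agree W x y → lookup (f x) i ≡ lookup (f y) i

Smallest : Pred (Subset m) 0ℓ → Pred (Subset m) 0ℓ
Smallest P W = P W × (∀ V → P V → W ⊆ V)

private
  allVec? : {P : Pred (Vec (Fin b) m) 0ℓ} → U.Decidable P → Dec (∀ x → P x)
  allVec? {m = zero}  P? = map′ (λ { p [] → p }) (λ p → p []) (P? [])
  allVec? {m = suc m} P? =
    map′ (λ { p (c ∷ x) → p c x }) (λ p c x → p (c ∷ x))
         (all? (λ c → allVec? (λ x → P? (c ∷ x))))

  determines? : (f : Vec (Fin b) m → Vec (Fin a) n) (i : Fin n) →
                U.Decidable (Determines f i)
  determines? f i W = allVec? λ x → allVec? λ y →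
    all? (λ j → (j ∈? W) →-dec (lookup x j ≟ lookup y j))
    →-dec (lookup (f x) i ≟ lookup (f y) i)

  ⊤-determines : (f : Vec (Fin b) m → Vec (Fin a) n) (i : Fin n) →
                 Determines f i ⊤
  ⊤-determines f i x y x≈y = cong (λ z → lookup (f z) i)
    (trans (sym (tabulate∘lookup x))
    (trans (tabulate-cong (λ j → x≈y j ∈⊤)) (tabulate∘lookup y)))

  ∩-determines : (f : Vec (Fin b) m → Vec (Fin a) n) (i : Fin n) {V W : Subset m} →
                 Determines f i V → Determines f i W → Determines f i (V ∩ W)
  ∩-determines f i {V} {W} dV dW x y x≈y = trans (dV x z x≈z) (dW z y z≈y)
    where
    mix : Fin _ → Fin _
    mix j = if does (j ∈? V) then lookup x j else lookup y j

    z = tabulate mix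

    x≈mix : ∀ j → j ∈ V → lookup x j ≡ mix j
    x≈mix j j∈V with j ∈? V
    ... | yes _   = refl
    ... | no  j∉V = contradiction j∈V j∉V

    mix≈y : ∀ j → j ∈ W → mix j ≡ lookup y j
    mix≈y j j∈W with j ∈? V
    ... | yes j∈V = x≈y j (x∈p∩q⁺ (j∈V , j∈W))
    ... | no  _   = refl

    x≈z : Agree V x z
    x≈z j j∈V = trans (x≈mix j j∈V) (sym (lookup∘tabulate mix j))

    z≈y : Agree W z y
    z≈y j j∈W = trans (lookup∘tabulate mix j) (mix≈y j j∈W)

  smallest : {P : Pred (Subset m) 0ℓ} → U.Decidable P →
             (∀ {V W} → P V → P W → P (V ∩ W)) →
             ∀ W → Acc _⊂_ W → P W → ∃ (Smallest P)
  smallest {P = P} P? P-∩ W (acc rec) pW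
    with anySubset? (λ V → P? V ×-dec ((W ∩ V) ⊂? W))
  ... | yes (V , pV , W∩V⊂W) = smallest P? P-∩ (W ∩ V) (rec W∩V⊂W) (P-∩ pW pV)
  ... | no  none = W , pW , least
    where
    least : ∀ V → P V → W ⊆ V
    least V pV {j} j∈W with j ∈? V
    ... | yes j∈V = j∈V
    ... | no  j∉V = contradiction
      (V , pV , (λ {k} → p∩q⊆p W V {k}) , j , j∈W , λ j∈W∩V → j∉V (proj₂ (x∈p∩q⁻ W V j∈W∩V)))
      none

window-exists : (f : Vec (Fin b) m → Vec (Fin a) n) (i : Fin n) →
                ∃ (Smallest (Determines f i))
window-exists f i = smallest (determines? f i) (∩-determines f i)
  ⊤ (⊂-wellFounded ⊤) (⊤-determines f i)

window : (Vec (Fin b) m → Vec (Fin a) n) → Fin n → Subset m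
window f i = proj₁ (window-exists f i)

window-smallest : (f : Vec (Fin b) m → Vec (Fin a) n) (i : Fin n) →
                  Smallest (Determines f i) (window f i)
window-smallest f i = proj₂ (window-exists f i)

------------------------------------------------------------------------
-- Simplicial complexes

record Complex (n : ℕ) : Set₁ where
  field
    Simplex   : Pred (Subset n) 0ℓ
    ∅-simplex : Simplex ⊥
    ⊆-closed  : ∀ {S T} → S ⊆ T → Simplex T → Simplex S

open Complex public

_⊆ᶜ_ : Complex n → Complex n → Set
K ⊆ᶜ L = Simplex K U.⊆ Simplex L

_≈ᶜ_ : Complex n → Complex n → Set
K ≈ᶜ L = Simplex K ≐ Simplex L

infix 4 _⊆ᶜ_ _≈ᶜ_

Δ : ∀ n → Complex n
Δ n = record
  { Simplex   = λ _ → Unit.⊤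
  ; ∅-simplex = Unit.tt
  ; ⊆-closed  = λ _ _ → Unit.tt
  }

-- The premise Nonempty S makes the empty set a simplex unconditionally,
-- also when the index set of the inputs is empty.
communicationComplex : (Vec (Fin b) m → Vec (Fin a) n) → Complex n
communicationComplex f = record
  { Simplex   = λ S → Nonempty S → ∃[ j ] (∀ i → i ∈ S → j ∈ window f i)
  ; ∅-simplex = λ { (_ , i∈∅) → ⊥-elim (∉⊥ i∈∅) }
  ; ⊆-closed  = λ { S⊆T T-simplex (i , i∈S) →
      let j , j∈⋂T = T-simplex (i , S⊆T i∈S)
      in  j , λ i′ i′∈S → j∈⋂T i′ (S⊆T i′∈S) }
  }

------------------------------------------------------------------------
-- Generation of languages

Language : ℕ → ℕ → Set₁
Language a n = Pred (Vec (Fin a) n) 0ℓ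

Image : (Vec (Fin b) m → Vec (Fin a) n) → Language a n
Image f w = ∃[ x ] f x ≡ w

Generates : Complex n → Language a n → Set
Generates {n} {a} K L =
  ∃[ b ] ∃[ m ] Σ (Vec (Fin b) m → Vec (Fin a) n) λ f →
    Image f ≐ L × communicationComplex f ⊆ᶜ K

zerosOnes : ∀ n k → .(k ≤ n) → Vec (Fin 2) n
zerosOnes n k k≤n = cast (m+[n∸m]≡n k≤n) (replicate k 0F ++ replicate (n ∸ k) 1F)

ND : ∀ n → Language 2 n
ND n w = ∃[ k ] Σ (k ≤ n) λ k≤n → w ≡ zerosOnes n k k≤n

{-# OPTIONS --safe #-}

-- Let x be an input with output 1ⁿ and y one with output 0ⁿ.  If no input is
-- read by all outputs, each input j has an output c j that does not read it.
-- Turn x into y in n steps, replacing at step k the inputs j with c j = k.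
-- Output k is not affected by step k, so inductively output k is 1 after
-- step k: output k ∸ 1 was 1 just before it, hence, by monotonicity, so was
-- output k.  After the last step the input is y, and the last output is
-- still 1: a contradiction.

module Submission where

open import Defs
open import Data.Bool.Base using (if_then_else_)
open import Data.Fin.Base as Fin using (Fin; zero; suc; toℕ; fromℕ; fromℕ<)
open import Data.Fin.Patterns using (0F; 1F)
open import Data.Fin.Properties
  using (all?; any?; ¬∀⟶∃¬; toℕ<n; toℕ≤pred[n]; toℕ-fromℕ; toℕ-fromℕ<; toℕ-injective)
open import Data.Fin.Subset using (_∈_; _∉_)
open import Data.Fin.Subset.Properties using (_∈?_; ⊆⊤)
open import Data.Nat.Base using (ℕ; zero; suc; _≤_; _<_; z≤n; s≤s; s≤s⁻¹)
open import Data.Nat.Properties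
  using (_<?_; ≤-refl; ≤-reflexive; ≤-trans; n≤1+n; m<n⇒m<1+n; m<1+n⇒m<n∨m≡n; <-≤-connex)
open import Data.Product.Base using (_×_; _,_; proj₁; proj₂; ∃-syntax)
open import Data.Sum.Base using (inj₁; inj₂)
open import Data.Vec.Base using (Vec; []; _∷_; lookup; tabulate)
open import Data.Vec.Properties using (lookup∘tabulate; tabulate∘lookup; tabulate-cong)
open import Function.Base using (_∘_)
open import Function.Bundles using (mk⇔)
open import Relation.Binary.PropositionalEquality
  using (_≡_; _≢_; refl; sym; trans; cong; subst)
open import Relation.Nullary.Decidable using (yes; no; does; dec-true; does-⇔)
open import Relation.Nullary.Negation using (contradiction)

private
  variable
    b m n k : ℕ

lookup-zerosOnes-< : ∀ .(k≤n : k ≤ n) (i : Fin n) → toℕ i < k →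
                     lookup (zerosOnes n k k≤n) i ≡ 0F
lookup-zerosOnes-< {suc k} k≤n zero    _   = refl
lookup-zerosOnes-< {suc k} k≤n (suc i) i<k = lookup-zerosOnes-< (s≤s⁻¹ k≤n) i (s≤s⁻¹ i<k)

lookup-zerosOnes-≥ : ∀ .(k≤n : k ≤ n) (i : Fin n) → k ≤ toℕ i →
                     lookup (zerosOnes n k k≤n) i ≡ 1F
lookup-zerosOnes-≥ {zero}  k≤n zero    _   = refl
lookup-zerosOnes-≥ {zero}  k≤n (suc i) _   = lookup-zerosOnes-≥ z≤n i z≤n
lookup-zerosOnes-≥ {suc k} k≤n (suc i) k≤i = lookup-zerosOnes-≥ (s≤s⁻¹ k≤n) i (s≤s⁻¹ k≤i)

-- Uniqueness uses only this property of `ND` and the presence of both constant words.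
UpwardClosed : Vec (Fin 2) n → Set
UpwardClosed w = ∀ i j → i Fin.≤ j → lookup w i ≡ 1F → lookup w j ≡ 1F

ND⇒UpwardClosed : {w : Vec (Fin 2) n} → ND n w → UpwardClosed w
ND⇒UpwardClosed (k , k≤n , refl) i j i≤j wᵢ≡1 with <-≤-connex (toℕ i) k
... | inj₁ i<k = contradiction (trans (sym (lookup-zerosOnes-< k≤n i i<k)) wᵢ≡1) λ ()
... | inj₂ k≤i = lookup-zerosOnes-≥ k≤n j (≤-trans k≤i i≤j)

module Interpolation (c : Fin m → Fin n) (x y : Vec (Fin b) m) where

  -- The state just before step `k`; step `k` leads to `interpolate (suc k)`.
  interpolate : ℕ → Vec (Fin b) m
  interpolate k = tabulate λ j → if does (toℕ (c j) <? k) then lookup y j else lookup x j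

  interpolate-start : interpolate 0 ≡ x
  -- `does (toℕ (c j) <? 0)` reduces to `false` even for a neutral `c j`.
  interpolate-start = tabulate∘lookup x

  interpolate-end : interpolate n ≡ y
  interpolate-end = trans
    (tabulate-cong λ j → cong (if_then lookup y j else lookup x j)
      (dec-true (toℕ (c j) <? n) (toℕ<n (c j))))
    (tabulate∘lookup y)

  -- The tests `_<? k` and `_<? suc k` differ only at `k` itself.
  interpolate-step : ∀ k j → toℕ (c j) ≢ k →
                     lookup (interpolate k) j ≡ lookup (interpolate (suc k)) j
  interpolate-step k j cⱼ≢k = trans (lookup∘tabulate _ j) (trans
    (cong (if_then lookup y j else lookup x j)
      (does-⇔ (mk⇔ m<n⇒m<1+n strict) (toℕ (c j) <? k) (toℕ (c j) <? suc k)))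
    (sym (lookup∘tabulate _ j)))
    where
    strict : toℕ (c j) < suc k → toℕ (c j) < k
    strict cⱼ<1+k with m<1+n⇒m<n∨m≡n cⱼ<1+k
    ... | inj₁ cⱼ<k = cⱼ<k
    ... | inj₂ cⱼ≡k = contradiction cⱼ≡k cⱼ≢k

module _ (f : Vec (Fin b) m → Vec (Fin 2) (suc n))
         (f-upward : ∀ x → UpwardClosed (f x)) where

  unread⇒last≡1 : (c : Fin m → Fin (suc n)) → (∀ j → j ∉ window f (c j)) →
                  ∀ x y → lookup (f x) zero ≡ 1F → lookup (f y) (fromℕ n) ≡ 1F
  unread⇒last≡1 c unread x y fx₀≡1 =
    subst (λ z → lookup (f z) (fromℕ n) ≡ 1F) interpolate-end
      -- After all `suc n` steps, the last output is the only one that the bound in `ones` still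
      -- covers.
      (ones (suc n) (fromℕ n) (s≤s (≤-reflexive (sym (toℕ-fromℕ n)))))
    where
    open Interpolation c x y

    step : ∀ k i → toℕ i ≡ k →
           lookup (f (interpolate k)) i ≡ lookup (f (interpolate (suc k))) i
    -- If step `k` changed an input `j` in the window of `i`, then `c j` would be `i`, which reads
    -- `j`.
    step k i i≡k = proj₁ (window-smallest f i) _ _ λ j j∈Wᵢ →
      interpolate-step k j λ cⱼ≡k →
        unread j (subst (λ i → j ∈ window f i) (toℕ-injective (trans i≡k (sym cⱼ≡k))) j∈Wᵢ)

    -- The invariant: before step `k`, all outputs from `k ∸ 1` on are 1. The bound avoids the
    -- truncated subtraction, so `k = 0` covers every output.
    ones : ∀ k i → k ≤ suc (toℕ i) → lookup (f (interpolate k)) i ≡ 1F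
    ones zero    i _   = subst (λ z → lookup (f z) i ≡ 1F) (sym interpolate-start)
      (f-upward x zero i z≤n fx₀≡1)
    ones (suc k) i k<1+i = f-upward _ i′ i (≤-trans (≤-reflexive i′≡k) (s≤s⁻¹ k<1+i))
      (trans (sym (step k i′ i′≡k))
        (ones k i′ (≤-trans (≤-reflexive (sym i′≡k)) (n≤1+n _))))
      where
      k<1+n = ≤-trans k<1+i (toℕ<n i)
      i′ = fromℕ< k<1+n
      i′≡k = toℕ-fromℕ< k<1+n

  common-input : ∀ x y → lookup (f x) zero ≡ 1F → lookup (f y) (fromℕ n) ≢ 1F →
                 ∃[ j ] (∀ i → j ∈ window f i)
  -- The search is finite; its failure yields, for each input, an output that does not read it,
  -- which is the required `c`.
  common-input x y fx₀≡1 fyₙ≢1 with any? (λ j → all? (λ i → j ∈? window f i))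
  ... | yes common = common
  ... | no  none   = contradiction
    (unread⇒last≡1 (proj₁ ∘ missing) (proj₂ ∘ missing) x y fx₀≡1) fyₙ≢1
    where
    missing : ∀ j → ∃[ i ] j ∉ window f i
    missing j = ¬∀⟶∃¬ _ _ (λ i → j ∈? window f i) λ j∈⋂W → none (j , j∈⋂W)

Δ-generates-ND : ∀ n → Generates (Δ n) (ND n)
-- A single input whose letter is the number of zeros, one of `suc n` values.
Δ-generates-ND n = suc n , 1 , f , (image⊆ND , ND⊆image) , _
  where
  f : Vec (Fin (suc n)) 1 → Vec (Fin 2) n
  f (k ∷ []) = zerosOnes n (toℕ k) (toℕ≤pred[n] k)

  image⊆ND : ∀ {w} → Image f w → ND n w
  image⊆ND ((k ∷ []) , refl) = toℕ k , toℕ≤pred[n] k , refl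

  -- The bounds are irrelevant, so matching on the equation identifies both words.
  zerosOnes-cong : ∀ {k l} .(k≤n : k ≤ n) .(l≤n : l ≤ n) → k ≡ l →
                   zerosOnes n k k≤n ≡ zerosOnes n l l≤n
  zerosOnes-cong _ _ refl = refl

  ND⊆image : ∀ {w} → ND n w → Image f w
  ND⊆image (k , k≤n , refl) = fromℕ< (s≤s k≤n) ∷ [] ,
    zerosOnes-cong (toℕ≤pred[n] (fromℕ< (s≤s k≤n))) k≤n (toℕ-fromℕ< (s≤s k≤n))

generates-ND⇒full : (K : Complex (suc n)) → Generates K (ND (suc n)) → K ≈ᶜ Δ (suc n)
generates-ND⇒full {n} K (_ , _ , f , (image⊆ND , ND⊆image) , K-f⊆K) =
  -- Every set lies in `⊤`, so one input read by all outputs suffices.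
  _ , λ _ → ⊆-closed K ⊆⊤ (K-f⊆K λ _ →
    -- No zeros for `x`, only zeros for `y`.
    let x , fx≡1 = ND⊆image (0 , z≤n , refl)
        y , fy≡0 = ND⊆image (suc n , ≤-refl , refl)
        j , j∈⋂W = common-input f (λ x → ND⇒UpwardClosed (image⊆ND {f x} (x , refl))) x y
          (cong (λ w → lookup w zero) fx≡1)
          λ fyₙ≡1 → contradiction
            (trans (sym fyₙ≡1) (trans (cong (λ w → lookup w (fromℕ n)) fy≡0)
              (lookup-zerosOnes-< ≤-refl (fromℕ n) (toℕ<n (fromℕ n)))))
            λ ()
    in j , λ i _ → j∈⋂W i)

proposition3p2 : ∀ (n : ℕ) → 1 ≤ n →
    Generates (Δ n) (ND n) ×
    (∀ (K : Complex n) → Generates K (ND n) → K ≈ᶜ Δ n)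
proposition3p2 (suc n) _ = Δ-generates-ND (suc n) , generates-ND⇒full
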